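{- Let $G=(V,E)$ be a graph. If $|V|=1$, the single vertex of $G$ is a forced codeword. If $|V|\ge 2$, then a vertex $u\in V$ is a forced codeword if and only if there exists a vertex $v\in V$ with $v\ne u$ and $N(u)\subseteq N[v]$.
   Context: All graphs are finite, simple and undirected (not necessarily connected). For $u\in V$, $N(u)$ is the set of neighbours of $u$ and $N[u]=N(u)\cup\{u\}$. A code is a non-empty subset $C\subseteq V$. For $u\in V$, $I(C;u)=N[u]\cap C$. A code $C$ is self-locating-dominating if for every $u\in V\setminus C$ we have $I(C;u)\neq\emptyset$ and $\bigcap_{c\in I(C;u)}N[c]=\{u\}$. A vertex $u$ is a forced codeword if $u$ belongs to every self-locating-dominating code of $G$. -}

module Defs where

open import Data.Nat.Base using (ℕ)
open import Data.Fin.Base using (Fin)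
open import Data.Fin.Subset as Subset using (Subset; Nonempty)
open import Data.Product.Base using (_×_; ∃; proj₁)
open import Level using (0ℓ)
open import Relation.Binary.Core using (Rel)
open import Relation.Binary.Definitions using (Decidable; Symmetric; Irreflexive)
open import Relation.Binary.PropositionalEquality.Core using (_≡_)
open import Relation.Unary using (Pred; _∈_; _∪_; _∩_; ⋂; _≐_; ｛_｝; Satisfiable)

-- The vertex set is Fin n, so |V| = n. Adjacency is decidable, as it is
-- for any explicitly given finite graph.
record Graph (n : ℕ) : Set₁ where
  field
    Adj    : Rel (Fin n) 0ℓ
    adj?   : Decidable Adj
    sym    : Symmetric Adj
    irrefl : Irreflexive _≡_ Adj

module _ {n : ℕ} (G : Graph n) where
  open Graph G

  N : Fin n → Pred (Fin n) 0ℓ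
  N u = Adj u

  N[_] : Fin n → Pred (Fin n) 0ℓ
  N[_] u = N u ∪ ｛ u ｝

  I : Subset n → Fin n → Pred (Fin n) 0ℓ
  I C u = N[_] u ∩ (Subset._∈ C)

  IsCode : Subset n → Set
  IsCode C = Nonempty C

  -- The intersection is indexed by pairs of a vertex c and a proof that
  -- c ∈ I(C;u).
  SelfLocatingDominating : Subset n → Set
  SelfLocatingDominating C =
    IsCode C ×
    (∀ u → u Subset.∉ C →
      Satisfiable (I C u) ×
      ⋂ (∃ (I C u)) (λ c → N[_] (proj₁ c)) ≐ ｛ u ｝)

  Forced : Fin n → Set
  Forced u = ∀ C → SelfLocatingDominating C → u Subset.∈ C

{-# OPTIONS --safe #-}
-- If N(u) ⊆ N[v] with v ≢ u and u ∉ C, then every c ∈ I(C;u) is a neighbour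
-- of u, so v lies in the intersection of the N[c], which is therefore not {u}.
-- Conversely, if there is no such v, then V ∖ {u} is self-locating-dominating.
module Submission where

open import Defs
open import Data.Nat.Base using (ℕ; _≤_; s≤s)
open import Data.Empty using (⊥-elim)
open import Data.Fin.Base using (Fin; zero; punchIn)
open import Data.Fin.Properties using (_≟_; any?; all?; punchInᵢ≢i)
open import Data.Fin.Subset as Subset using (∁; ⁅_⁆)
open import Data.Fin.Subset.Properties
  using (_∈?_; x∈⁅x⁆; x∈⁅y⁆⇒x≡y; x∈p⇒x∉∁p; x∉p⇒x∈∁p; x∉∁p⇒x∈p)
open import Data.Product.Base using (_×_; _,_; ∃; ∃-syntax)
open import Data.Sum.Base using (inj₁; inj₂)
open import Function.Base using (_∘_)
open import Function.Bundles using (_⇔_; mk⇔)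
open import Relation.Binary.PropositionalEquality using (_≡_; _≢_; refl; sym; subst)
open import Relation.Nullary.Decidable
  using (Dec; yes; no; map′; ¬?; _×-dec_; _⊎-dec_; _→-dec_; decidable-stable)
open import Relation.Nullary.Negation using (¬_; contradiction)
open import Relation.Unary using (_⊆_; _≐_; ⋂; ｛_｝; Satisfiable)

∃-distinct : ∀ {n} → 2 ≤ n → (u : Fin n) → ∃[ v ] v ≢ u
∃-distinct (s≤s (s≤s _)) u = punchIn u zero , punchInᵢ≢i u zero

module _ {n : ℕ} (G : Graph n) where
  open Graph G using (adj?) renaming (sym to Adj-sym)

  Dominated : Fin n → Set
  Dominated u = ∃[ v ] (v ≢ u × N G u ⊆ N[_] G v)

  N[]-sym : ∀ {u v} → N[_] G u v → N[_] G v u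
  N[]-sym (inj₁ a) = inj₁ (Adj-sym a)
  N[]-sym (inj₂ e) = inj₂ (sym e)

  -- Finiteness and `adj?` make the search effective; this is what lets `forced⇒dominated` extract
  -- an explicit `v` from a refutation of `¬ Dominated u`.
  dominated? : ∀ u → Dec (Dominated u)
  dominated? u = any? λ v → ¬? (v ≟ u) ×-dec
    map′ (λ f {w} → f w) (λ f w → f)
      (all? λ w → adj? u w →-dec (adj? v w ⊎-dec v ≟ w))

  dominated⇒forced : ∀ {u} → Dominated u → Forced G u
  dominated⇒forced {u} (v , v≢u , Nu⊆N[v]) C (_ , sld) =
    decidable-stable (u ∈? C) λ u∉C →
      let _ , ⋂⊆｛u｝ , _ = sld u u∉C
          v∈N[c] : ∀ {c} → I G C u c → N[_] G c v
          v∈N[c] = λ where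
            (inj₁ a , _)      → N[]-sym (Nu⊆N[v] a)
            (inj₂ refl , u∈C) → contradiction u∈C u∉C
      in v≢u (sym (⋂⊆｛u｝ λ (_ , c∈I) → v∈N[c] c∈I))

  ¬dominated⇒∁-sld : ∀ {u} → ∃[ v ] v ≢ u → ¬ Dominated u →
                     SelfLocatingDominating G (∁ ⁅ u ⁆)
  ¬dominated⇒∁-sld {u} (x , x≢u) ¬dom = (x , ≢⇒∈ x≢u) , λ w w∉C →
    -- The only vertex outside the code is `u`, so the condition is proved at `u` and transported to
    -- `w`.
    subst Separated (sym (x∈⁅y⁆⇒x≡y u (x∉∁p⇒x∈p w∉C)))
      (satisfiable , (λ {v} → ⋂⊆｛u｝ {v}) , λ where refl (_ , c∈N[u] , _) → N[]-sym c∈N[u])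
    where
    C = ∁ ⁅ u ⁆

    Separated : Fin n → Set
    Separated w = Satisfiable (I G C w) ×
      ⋂ (∃ (I G C w)) (λ (c , _) → N[_] G c) ≐ ｛ w ｝

    ≢⇒∈ : ∀ {v} → v ≢ u → v Subset.∈ C
    ≢⇒∈ v≢u = x∉p⇒x∈∁p (v≢u ∘ x∈⁅y⁆⇒x≡y u)

    -- Without loops, removing `u` from the code loses no neighbour of `u`, so `I G C u` contains
    -- all of `N G u`.
    adj⇒I : ∀ {v} → N G u v → I G C u v
    adj⇒I a = inj₁ a , ≢⇒∈ λ v≡u → Graph.irrefl G (sym v≡u) a

    -- An isolated u would be dominated by any other vertex.
    satisfiable : Satisfiable (I G C u)
    satisfiable with any? (adj? u)
    ... | yes (v , a) = v , adj⇒I a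
    ... | no isolated = ⊥-elim
      (¬dom (x , x≢u , λ a → contradiction (_ , a) isolated))

    -- A vertex `v ≢ u` in every `N[c]` would have each neighbour of `u` in its own closed
    -- neighbourhood, and so would dominate `u`.
    ⋂⊆｛u｝ : ∀ {v} → (((c , _) : ∃ (I G C u)) → N[_] G c v) → u ≡ v
    ⋂⊆｛u｝ {v} v∈⋂ = decidable-stable (u ≟ v) λ u≢v →
      ¬dom (v , u≢v ∘ sym , λ a → N[]-sym (v∈⋂ (_ , adj⇒I a)))

  forced⇒dominated : ∀ {u} → ∃[ v ] v ≢ u → Forced G u → Dominated u
  forced⇒dominated {u} other forced = decidable-stable (dominated? u) λ ¬dom →
    -- Being forced puts `u` into `∁ ⁅ u ⁆`, which is absurd.
    x∈p⇒x∉∁p (x∈⁅x⁆ u) (forced _ (¬dominated⇒∁-sld other ¬dom))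

mainTheorem3 : ∀ (n : ℕ) (G : Graph n) →
    (n ≡ 1 → ∀ (u : Fin n) → Forced G u) ×
    (2 ≤ n → ∀ (u : Fin n) →
    Forced G u ⇔ (∃[ v ] (v ≢ u × N G u ⊆ N[_] G v)))
mainTheorem3 n G =
  -- A code is non-empty, so on one vertex it must contain that vertex.
  (λ where refl zero C ((zero , 0∈C) , _) → 0∈C) ,
  λ 2≤n u → mk⇔ (forced⇒dominated G (∃-distinct 2≤n u)) (dominated⇒forced G)
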